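{- Let $AP$ be a finite set, let $\mathcal{A}=(Q,2^{AP},\delta,Q_0,F)$ be a complete nondeterministic Büchi automaton (NBA), and let $M=(S,P,I,AP,L)$ be a finite possibilistic Kripke structure. Then for all states $s$ in $M$, $$Po^M(s\models\mathcal{A})=Po^{M\otimes\mathcal{A}}\big(\langle s,\delta(q_0,L(s))\rangle\models\square\lozenge B\big),\qquad B=S\times F.$$
   Context: For subsets or families in $[0,1]$, $\vee$ denotes supremum and $\wedge$ infimum (with $\bigvee\emptyset=0$). A possibilistic Kripke structure is a tuple $M=(S,P,I,AP,L)$ where $S$ is a countable nonempty set of states; $P:S\times S\to[0,1]$ satisfies $\bigvee_{s'\in S}P(s,s')=1$ for all $s\in S$; $I:S\to[0,1]$ satisfies $\bigvee_{s\in S}I(s)=1$; $AP$ is a set of atomic propositions; and $L:S\to 2^{AP}$ is a labeling function. It is finite if $S$ and $AP$ are finite. A path is an infinite sequence $\pi=s_0s_1\cdots\in S^\omega$ with $P(s_i,s_{i+1})>0$ for all $i\ge 0$; $Paths(s)$ is the set of paths with $s_0=s$; $trace(\pi)=L(s_0)L(s_1)\cdots\in(2^{AP})^\omega$. Define $Po^M(\pi)=I(s_0)\wedge\bigwedge_{i=0}^\infty P(s_i,s_{i+1})$ and $Po^M(E)=\bigvee_{\pi\in E}Po^M(\pi)$ for a set $E$ of paths. $M_s$ is $M$ with $I$ replaced by the distribution that is $1$ at $s$ and $0$ elsewhere. For a set of paths $E$, $Po^M(s\models E)=Po^{M_s}(E\cap Paths(s))$. For a set $B$ of states, $\square\lozenge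 B$ is the set of paths that visit $B$ infinitely often. An NBA $\mathcal{A}=(Q,\Sigma,\delta,Q_0,F)$ has a finite state set $Q$, finite alphabet $\Sigma$, transition function $\delta:Q\times\Sigma\to2^Q$, initial states $Q_0\subseteq Q$ and accept states $F\subseteq Q$; $L_\omega(\mathcal A)\subseteq\Sigma^\omega$ is the set of infinite words $u_1u_2\cdots$ having a run $q_0q_1\cdots$ with $q_0\in Q_0$, $q_{i+1}\in\delta(q_i,u_{i+1})$ for all $i\ge0$, and $q_i\in F$ for infinitely many $i$. $\mathcal A$ is complete if $\delta(q,u)\ne\emptyset$ for all $q\in Q$, $u\in\Sigma$. Define $Po^M(s\models\mathcal A)=Po^{M_s}(\{\pi\in Paths(s)\mid trace(\pi)\in L_\omega(\mathcal A)\})$. The product $M\otimes\mathcal A=(S\times Q,P',I',AP',L')$ is given by $AP'=S\times Q$, $L'(\langle s,q\rangle)=\{\langle s,q\rangle\}$; $I'(\langle s,q\rangle)=I(s)$ if $q\in\delta(q_0,L(s))$ for some $q_0\in Q_0$, and $0$ otherwise; $P'(\langle s,q\rangle,\langle s',q'\rangle)=P(s,s')$ if $q'\in\delta(q,L(s'))$, and $0$ otherwise. Here $Po^{M\otimes\mathcal A}(\langle s,\delta(q_0,L(s))\rangle\models E)$ means the supremum of $Po^{M\otimes\mathcal A}(\langle s,q\rangle\models E)$ over all $q\in\delta(q_0,L(s))$ with $q_0\in Q_0$. -}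

module Defs where

open import Data.Bool using (Bool; if_then_else_)
open import Data.Fin using (Fin)
import Data.Fin.Properties as Fin
open import Data.Fin.Subset using (Subset; _∈_; Nonempty)
open import Data.Fin.Subset.Properties using (_∈?_)
open import Data.Nat using (ℕ; suc)
import Data.Nat as ℕ
open import Data.Product using (∃; _×_; _,_; proj₁; proj₂)
import Data.Product.Properties as Product
open import Data.Rational using (ℚ; 0ℚ; 1ℚ)
import Data.Rational as ℚ
import Data.Rational.Properties as ℚ
open import Data.Sum using (_⊎_; inj₁; inj₂)
open import Data.Vec using (tabulate)
open import Function using (_↣_; _↔_; _∘_)
open import Level using (0ℓ)
open import Relation.Binary.Definitions using (DecidableEquality)
open import Relation.Binary.PropositionalEquality using (_≡_)
open import Relation.Nullary using (¬_; Dec; does)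
open import Relation.Nullary.Decidable using (_×-dec_)
open import Relation.Unary using (Pred; _∩_)

------------------------------------------------------------------------
-- The real unit interval

-- A real x ∈ [0,1] is represented by its Dedekind cut { q ∈ ℚ ∣ q < x }:
-- a downward closed set of rationals without a greatest element, containing
-- every q < 0 (so 0 ≤ x) and contained in { q ∣ q < 1 } (so x ≤ 1).
-- No locatedness is required, so that all suprema and infima exist
-- constructively; classically every cut is located.
record 𝕀 : Set₁ where
  field
    cut     : Pred ℚ 0ℓ
    lower   : ∀ {q r} → q ℚ.< r → cut r → cut q
    rounded : ∀ {q} → cut q → ∃ λ r → q ℚ.< r × cut r
    0≤      : ∀ {q} → q ℚ.< 0ℚ → cut q
    ≤1      : ∀ {q} → cut q → q ℚ.< 1ℚ

open 𝕀 public using (cut)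

infix 4 _≤_ _<_ _≈_

_≤_ : 𝕀 → 𝕀 → Set
x ≤ y = ∀ q → cut x q → cut y q

_<_ : 𝕀 → 𝕀 → Set
x < y = ∃ λ q → ¬ cut x q × cut y q

_≈_ : 𝕀 → 𝕀 → Set
x ≈ y = x ≤ y × y ≤ x

private
  0<1 : 0ℚ ℚ.< 1ℚ
  0<1 = ℚ.positive⁻¹ 1ℚ

𝟘 : 𝕀
𝟘 = record
  { cut     = ℚ._< 0ℚ
  ; lower   = ℚ.<-trans
  ; rounded = ℚ.<-dense
  ; 0≤      = λ q<0 → q<0
  ; ≤1      = λ q<0 → ℚ.<-trans q<0 0<1
  }

𝟙 : 𝕀
𝟙 = record
  { cut     = ℚ._< 1ℚ
  ; lower   = ℚ.<-trans
  ; rounded = ℚ.<-dense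
  ; 0≤      = λ q<0 → ℚ.<-trans q<0 0<1
  ; ≤1      = λ q<1 → q<1
  }

⋁ : {J : Set} → (J → 𝕀) → 𝕀
⋁ {J} f = record
  { cut     = λ q → q ℚ.< 0ℚ ⊎ ∃ λ j → cut (f j) q
  ; lower   = λ where
      q<r (inj₁ r<0)       → inj₁ (ℚ.<-trans q<r r<0)
      q<r (inj₂ (j , r∈f)) → inj₂ (j , 𝕀.lower (f j) q<r r∈f)
  ; rounded = λ where
      (inj₁ q<0)       → let r , q<r , r<0 = ℚ.<-dense q<0 in r , q<r , inj₁ r<0
      (inj₂ (j , q∈f)) → let r , q<r , r∈f = 𝕀.rounded (f j) q∈f in r , q<r , inj₂ (j , r∈f)
  ; 0≤      = inj₁
  ; ≤1      = λ where
      (inj₁ q<0)       → ℚ.<-trans q<0 0<1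
      (inj₂ (j , q∈f)) → 𝕀.≤1 (f j) q∈f
  }

-- The intersection of the cuts may have a greatest element, hence the r above q.
-- The bound r < 1 only matters for empty J, where the infimum in [0,1] is 1.
⋀ : {J : Set} → (J → 𝕀) → 𝕀
⋀ {J} f = record
  { cut     = λ q → ∃ λ r → q ℚ.< r × r ℚ.< 1ℚ × (∀ j → cut (f j) r)
  ; lower   = λ { q<p (r , p<r , rest) → r , ℚ.<-trans q<p p<r , rest }
  ; rounded = λ { (r , q<r , rest) → let p , q<p , p<r = ℚ.<-dense q<r in p , q<p , (r , p<r , rest) }
  ; 0≤      = λ q<0 → let r , q<r , r<0 = ℚ.<-dense q<0 in
                      r , q<r , ℚ.<-trans r<0 0<1 , λ j → 𝕀.0≤ (f j) r<0
  ; ≤1      = λ { (r , q<r , r<1 , _) → ℚ.<-trans q<r r<1 }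
  }

⋁-upper : {J : Set} (f : J → 𝕀) → ∀ j → f j ≤ ⋁ f
⋁-upper f j q q∈f = inj₂ (j , q∈f)

⋁-least : {J : Set} (f : J → 𝕀) (x : 𝕀) → (∀ j → f j ≤ x) → ⋁ f ≤ x
⋁-least f x f≤x q (inj₁ q<0)       = 𝕀.0≤ x q<0
⋁-least f x f≤x q (inj₂ (j , q∈f)) = f≤x j q q∈f

⋀-lower : {J : Set} (f : J → 𝕀) → ∀ j → ⋀ f ≤ f j
⋀-lower f j q (r , q<r , _ , r∈f) = 𝕀.lower (f j) q<r (r∈f j)

⋀-greatest : {J : Set} (f : J → 𝕀) (x : 𝕀) → (∀ j → x ≤ f j) → x ≤ ⋀ f
⋀-greatest f x x≤f q q∈x =
  let r , q<r , r∈x = 𝕀.rounded x q∈x in r , q<r , 𝕀.≤1 x r∈x , λ j → x≤f j r r∈x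

infixr 6 _∧_

_∧_ : 𝕀 → 𝕀 → 𝕀
x ∧ y = ⋀ {Bool} (λ b → if b then x else y)

------------------------------------------------------------------------
-- Possibilistic Kripke structures

InfinitelyOften : Pred ℕ 0ℓ → Set
InfinitelyOften R = ∀ n → ∃ λ m → n ℕ.≤ m × R m

Finite : Set → Set
Finite A = ∃ λ n → A ↔ Fin n

-- The bare tuple (S, P, I, AP, L); the conditions on it are in IsPKS.  They are
-- kept apart because a product M ⊗ 𝒜 can violate them, e.g. if 𝒜 has no initial
-- state.  Decidable equality on S serves to define M_s; it holds for any
-- countable S in the sense of IsPKS.  2^AP is AP → Bool.
record Structure (AP : Set) : Set₁ where
  field
    State : Set
    _≟_   : DecidableEquality State
    P     : State → State → 𝕀
    I     : State → 𝕀
    L     : State → AP → Bool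

record IsPKS {AP : Set} (M : Structure AP) : Set where
  open Structure M
  field
    countable : State ↣ ℕ
    nonempty  : State
    P-normal  : ∀ s → ⋁ (λ s′ → P s s′) ≈ 𝟙
    I-normal  : ⋁ I ≈ 𝟙

module _ {AP : Set} (M : Structure AP) where
  open Structure M

  IsFinite : Set
  IsFinite = Finite State × Finite AP

  Path : Set
  Path = ∃ λ (π : ℕ → State) → ∀ i → 𝟘 < P (π i) (π (suc i))

  Paths : State → Pred Path 0ℓ
  Paths s π = proj₁ π 0 ≡ s

  trace : Path → ℕ → AP → Bool
  trace π i = L (proj₁ π i)

  Po-path : Path → 𝕀
  Po-path (π , _) = I (π 0) ∧ ⋀ (λ i → P (π i) (π (suc i)))

  Po : Pred Path 0ℓ → 𝕀
  Po E = ⋁ {∃ E} (λ π∈E → Po-path (proj₁ π∈E))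

  □◇ : Pred State 0ℓ → Pred Path 0ℓ
  □◇ B π = InfinitelyOften (λ i → B (proj₁ π i))

  startingAt : State → Structure AP
  startingAt s = record M { I = λ t → if does (t ≟ s) then 𝟙 else 𝟘 }

-- M and M_s have definitionally the same paths.
Po⊨ : {AP : Set} (M : Structure AP) → Structure.State M → Pred (Path M) 0ℓ → 𝕀
Po⊨ M s E = Po (startingAt M s) (E ∩ Paths M s)

------------------------------------------------------------------------
-- Nondeterministic Büchi automata

record NBA (Σ : Set) : Set where
  field
    size : ℕ

  Q : Set
  Q = Fin size

  field
    finite-Σ : Finite Σ
    δ        : Q → Σ → Subset size
    Q₀       : Subset size
    F        : Subset size

module _ {Σ : Set} (𝒜 : NBA Σ) where
  open NBA 𝒜

  -- The word u₁u₂⋯ is the function i ↦ u_{i+1}.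
  Lω : Pred (ℕ → Σ) 0ℓ
  Lω u = ∃ λ (q : ℕ → Q) →
    q 0 ∈ Q₀ × (∀ i → q (suc i) ∈ δ (q i) (u i)) × InfinitelyOften (λ i → q i ∈ F)

  Complete : Set
  Complete = ∀ q u → Nonempty (δ q u)

  -- q ∈ δ(q₀, u) for some q₀ ∈ Q₀
  Initial : Σ → Pred Q 0ℓ
  Initial u q = ∃ λ q₀ → q₀ ∈ Q₀ × q ∈ δ q₀ u

  initial? : ∀ u q → Dec (Initial u q)
  initial? u q = Fin.any? (λ q₀ → (q₀ ∈? Q₀) ×-dec (q ∈? δ q₀ u))

-- For AP = Fin k the alphabet 2^AP is Subset k, i.e. the characteristic
-- functions Fin k → Bool in tabulated form.
module _ {k : ℕ} (M : Structure (Fin k)) (𝒜 : NBA (Subset k)) where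
  open Structure M
  open NBA 𝒜

  letter : State → Subset k
  letter s = tabulate (L s)

  Po⊨NBA : State → 𝕀
  Po⊨NBA s = Po⊨ M s (λ π → Lω 𝒜 (tabulate ∘ trace M π))

  private
    _≟′_ : DecidableEquality (State × Q)
    _≟′_ = Product.≡-dec _≟_ Fin._≟_

  _⊗_ : Structure (State × Q)
  _⊗_ = record
    { State = State × Q
    ; _≟_   = _≟′_
    ; P     = λ (s , q) (s′ , q′) → if does (q′ ∈? δ q (letter s′)) then P s s′ else 𝟘
    ; I     = λ (s , q) → if does (initial? 𝒜 (letter s) q) then I s else 𝟘
    ; L     = λ x y → does (y ≟′ x)
    }

  -- Po(⟨s, δ(q₀, L(s))⟩ ⊨ E) in M ⊗ 𝒜
  Po⊗⊨ : State → Pred (Path _⊗_) 0ℓ → 𝕀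
  Po⊗⊨ s E = ⋁ {∃ (Initial 𝒜 (letter s))} (λ q → Po⊨ _⊗_ (s , proj₁ q) E)

{-# OPTIONS --safe #-}

-- The paths ⟨s₀,q₁⟩⟨s₁,q₂⟩⋯ of M ⊗ 𝒜 that start in ⟨s,δ(q₀,L(s))⟩ and visit B
-- infinitely often are exactly the pairings of a path s₀s₁⋯ of M from s with an
-- accepting run q₀q₁q₂⋯ on its trace, without its first state q₀.  Along such a
-- path P′ agrees with P, so the path of M and the path of M ⊗ 𝒜 have the same
-- possibility, and the two suprema range over the same values.
module Submission where

open import Data.Bool using (true; false; if_then_else_)
open import Data.Empty using (⊥-elim)
open import Data.Fin using (Fin)
open import Data.Fin.Subset using (Subset; _∈_)
open import Data.Fin.Subset.Properties using (_∈?_)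
open import Data.Nat using (ℕ; zero; suc; s≤s⁻¹)
open import Data.Nat.Properties using (m≤n⇒m≤1+n)
open import Data.Product using (_×_; _,_; proj₁; proj₂)
open import Data.Vec using (tabulate)
open import Function using (_∘_)
open import Level using (0ℓ)
open import Relation.Binary.PropositionalEquality using (refl; sym; cong; subst)
open import Relation.Nullary using (Dec; yes; no; does)
open import Relation.Unary using (Pred)
open import Defs

≤-trans : ∀ x y z → x ≤ y → y ≤ z → x ≤ z
≤-trans _ _ _ x≤y y≤z q = y≤z q ∘ x≤y q

x≤𝟙 : ∀ x → x ≤ 𝟙
x≤𝟙 x _ = 𝕀.≤1 x

⋀-mono : {J : Set} (f g : J → 𝕀) → (∀ j → f j ≤ g j) → ⋀ f ≤ ⋀ g
⋀-mono f g f≤g = ⋀-greatest g (⋀ f) λ j →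
  ≤-trans (⋀ f) (f j) (g j) (⋀-lower f j) (f≤g j)

<-≤-trans : ∀ x y z → x < y → y ≤ z → x < z
<-≤-trans _ _ _ (q , q∉x , q∈y) y≤z = q , q∉x , y≤z q q∈y

module _ {A : Set} (x : 𝕀) where

  if-then-𝟘≤ : (a? : Dec A) → (if does a? then x else 𝟘) ≤ x
  if-then-𝟘≤ (yes _) _ q∈x = q∈x
  if-then-𝟘≤ (no _)  _ q<0 = 𝕀.0≤ x q<0

  ≤if-then-𝟘 : (a? : Dec A) → A → x ≤ (if does a? then x else 𝟘)
  ≤if-then-𝟘 (yes _) _ _ q∈x = q∈x
  ≤if-then-𝟘 (no ¬a) a       = ⊥-elim (¬a a)

  -- In the `no` case a single rational would have to be both negative and not negative. This is how
  -- the positive edges of a product path yield automaton transitions.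
  0<if-then-𝟘 : (a? : Dec A) → 𝟘 < (if does a? then x else 𝟘) → A
  0<if-then-𝟘 (yes a) _               = a
  0<if-then-𝟘 (no _)  (_ , q≮0 , q<0) = ⊥-elim (q≮0 q<0)

module _ {AP : Set} (M : Structure AP) where
  open Structure M

  Pᵢ : Path M → ℕ → 𝕀
  Pᵢ (π , _) i = P (π i) (π (suc i))

  ⋀P : Path M → 𝕀
  ⋀P π = ⋀ (Pᵢ π)

  -- In M_s, a path from s has I(s₀) = 1, so its possibility is ⋀P.
  ⋀P≤Po⊨ : ∀ s (E : Pred (Path M) 0ℓ) π → E π → Paths M s π → ⋀P π ≤ Po⊨ M s E
  ⋀P≤Po⊨ s E π π∈E π₀≡s =
    ≤-trans (⋀P π) (Po-path Mₛ π) (Po⊨ M s E)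
      (⋀-greatest (λ b → if b then Structure.I Mₛ (proj₁ π 0) else ⋀P π) (⋀P π) λ where
        true  → ≤-trans (⋀P π) 𝟙 (Structure.I Mₛ (proj₁ π 0)) (x≤𝟙 (⋀P π))
                  (≤if-then-𝟘 𝟙 (proj₁ π 0 ≟ s) π₀≡s)
        false → λ _ q∈⋀P → q∈⋀P)
      (⋁-upper (Po-path Mₛ ∘ proj₁) (π , π∈E , π₀≡s))
    where
    Mₛ : Structure AP
    Mₛ = startingAt M s

  -- Dropping the initial possibility from the meet only raises the value. Together with `⋀P≤Po⊨`,
  -- this makes `Po⊨ M s E` the supremum of `⋀P` over the paths in `E` from `s`, so initial
  -- distributions play no part in the two inequalities below.
  Po⊨-least : ∀ s (E : Pred (Path M) 0ℓ) x →
    (∀ π → E π → Paths M s π → ⋀P π ≤ x) → Po⊨ M s E ≤ x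
  Po⊨-least s E x ⋀P≤x = ⋁-least (Po-path Mₛ ∘ proj₁) x λ (π , π∈E , π₀≡s) →
    ≤-trans (Po-path Mₛ π) (⋀P π) x
      (⋀-lower (λ b → if b then Structure.I Mₛ (proj₁ π 0) else ⋀P π) false)
      (⋀P≤x π π∈E π₀≡s)
    where
    Mₛ : Structure AP
    Mₛ = startingAt M s

module _ {k : ℕ} (M : Structure (Fin k)) (𝒜 : NBA (Subset k)) where
  open Structure M
  open NBA 𝒜

  Accepted : Pred (Path M) 0ℓ
  Accepted π = Lω 𝒜 (tabulate ∘ trace M π)

  □◇F : Pred (Path (M ⊗ 𝒜)) 0ℓ
  □◇F = □◇ (M ⊗ 𝒜) λ (_ , q) → q ∈ F

  P′ : State × Q → State × Q → 𝕀
  P′ = Structure.P (M ⊗ 𝒜)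

  P′≤P : ∀ s q s′ q′ → P′ (s , q) (s′ , q′) ≤ P s s′
  P′≤P s q s′ q′ = if-then-𝟘≤ (P s s′) (q′ ∈? δ q (letter M 𝒜 s′))

  P≤P′ : ∀ s q s′ q′ → q′ ∈ δ q (letter M 𝒜 s′) → P s s′ ≤ P′ (s , q) (s′ , q′)
  P≤P′ s q s′ q′ = ≤if-then-𝟘 (P s s′) (q′ ∈? δ q (letter M 𝒜 s′))

  0<P′⇒∈δ : ∀ s q s′ q′ → 𝟘 < P′ (s , q) (s′ , q′) → q′ ∈ δ q (letter M 𝒜 s′)
  0<P′⇒∈δ s q s′ q′ = 0<if-then-𝟘 (P s s′) (q′ ∈? δ q (letter M 𝒜 s′))

  Po⊨NBA≤Po⊗⊨ : ∀ s → Po⊨NBA M 𝒜 s ≤ Po⊗⊨ M 𝒜 s □◇F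
  Po⊨NBA≤Po⊗⊨ s = Po⊨-least M s Accepted (Po⊗⊨ M 𝒜 s □◇F) ⋀P≤Po⊗⊨
    where
    ⋀P≤Po⊗⊨ : ∀ π → Accepted π → Paths M s π → ⋀P M π ≤ Po⊗⊨ M 𝒜 s □◇F
    ⋀P≤Po⊗⊨ (π , 0<P) (q , q₀∈Q₀ , step , accepting) refl =
      ≤-trans (⋀P M (π , 0<P)) (⋀P (M ⊗ 𝒜) ρ) (Po⊗⊨ M 𝒜 s □◇F)
        (⋀-mono (Pᵢ M (π , 0<P)) (Pᵢ (M ⊗ 𝒜) ρ) P≤P′ᵢ)
        (≤-trans (⋀P (M ⊗ 𝒜) ρ) (Po⊨ (M ⊗ 𝒜) (s , q 1) □◇F) (Po⊗⊨ M 𝒜 s □◇F)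
          (⋀P≤Po⊨ (M ⊗ 𝒜) (s , q 1) □◇F ρ ρ∈□◇F refl)
          -- `q 1` is the state reached after reading the letter of `s`, hence the automaton
          -- component of the start of `ρ`.
          (⋁-upper (λ (r , _) → Po⊨ (M ⊗ 𝒜) (s , r) □◇F) (q 1 , q 0 , q₀∈Q₀ , step 0)))
      where
      P≤P′ᵢ : ∀ i → P (π i) (π (suc i)) ≤ P′ (π i , q (suc i)) (π (suc i) , q (suc (suc i)))
      -- `P′` reads the label of its target `π (suc i)`, which the run consumes at step `suc i`.
      P≤P′ᵢ i = P≤P′ (π i) (q (suc i)) (π (suc i)) (q (suc (suc i))) (step (suc i))

      ρ : Path (M ⊗ 𝒜)
      ρ = (λ i → π i , q (suc i)) , λ i →
        <-≤-trans 𝟘 (P (π i) (π (suc i)))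
          (P′ (π i , q (suc i)) (π (suc i) , q (suc (suc i)))) (0<P i) (P≤P′ᵢ i)

      ρ∈□◇F : □◇F ρ
      -- Asking for a visit beyond `n` excludes position 0, which `ρ` omits, and leaves a bound of
      -- `n` after the shift by one.
      ρ∈□◇F n with accepting (suc n)
      ... | suc m , n<m , qₘ∈F = m , s≤s⁻¹ n<m , qₘ∈F

  Po⊗⊨≤Po⊨NBA : ∀ s → Po⊗⊨ M 𝒜 s □◇F ≤ Po⊨NBA M 𝒜 s
  Po⊗⊨≤Po⊨NBA s = ⋁-least (λ (q , _) → Po⊨ (M ⊗ 𝒜) (s , q) □◇F) (Po⊨NBA M 𝒜 s) λ (q , init) →
    Po⊨-least (M ⊗ 𝒜) (s , q) □◇F (Po⊨NBA M 𝒜 s) (⋀P′≤Po⊨NBA q init)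
    where
    ⋀P′≤Po⊨NBA : ∀ q → Initial 𝒜 (letter M 𝒜 s) q →
      ∀ ρ → □◇F ρ → Paths (M ⊗ 𝒜) (s , q) ρ → ⋀P (M ⊗ 𝒜) ρ ≤ Po⊨NBA M 𝒜 s
    ⋀P′≤Po⊨NBA q (q₀ , q₀∈Q₀ , q∈δ) (ρ , 0<P′) ρ∈□◇F ρ₀≡ =
      ≤-trans (⋀P (M ⊗ 𝒜) (ρ , 0<P′)) (⋀P M π) (Po⊨NBA M 𝒜 s)
        (⋀-mono (Pᵢ (M ⊗ 𝒜) (ρ , 0<P′)) (Pᵢ M π) P′≤Pᵢ)
        (⋀P≤Po⊨ M s Accepted π (run , q₀∈Q₀ , step , accepting) (cong proj₁ ρ₀≡))
      where
      P′≤Pᵢ : ∀ i → P′ (ρ i) (ρ (suc i)) ≤ P (proj₁ (ρ i)) (proj₁ (ρ (suc i)))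
      P′≤Pᵢ i = P′≤P (proj₁ (ρ i)) (proj₂ (ρ i)) (proj₁ (ρ (suc i))) (proj₂ (ρ (suc i)))

      π : Path M
      π = proj₁ ∘ ρ , λ i →
        <-≤-trans 𝟘 (P′ (ρ i) (ρ (suc i))) (P (proj₁ (ρ i)) (proj₁ (ρ (suc i)))) (0<P′ i) (P′≤Pᵢ i)

      -- The initiality witness `q₀` is put back in front of the automaton components of `ρ`.
      run : ℕ → Q
      run zero    = q₀
      run (suc i) = proj₂ (ρ i)

      step : ∀ i → run (suc i) ∈ δ (run i) (letter M 𝒜 (proj₁ (ρ i)))
      -- The first transition comes from initiality, the later ones from positivity of `P′`.
      step zero    = subst (λ (t , r) → r ∈ δ q₀ (letter M 𝒜 t)) (sym ρ₀≡) q∈δ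
      step (suc i) = 0<P′⇒∈δ (proj₁ (ρ i)) (proj₂ (ρ i)) (proj₁ (ρ (suc i))) (proj₂ (ρ (suc i))) (0<P′ i)

      accepting : InfinitelyOften λ i → run i ∈ F
      accepting n = let m , n≤m , qₘ∈F = ρ∈□◇F n in suc m , m≤n⇒m≤1+n n≤m , qₘ∈F

theorem20 : (k : ℕ) (𝒜 : NBA (Subset k)) → Complete 𝒜 →
    (M : Structure (Fin k)) → IsPKS M → IsFinite M →
    (s : Structure.State M) →
    Po⊨NBA M 𝒜 s ≈ Po⊗⊨ M 𝒜 s (□◇ (M ⊗ 𝒜) (λ (_ , q) → q ∈ NBA.F 𝒜))
theorem20 k 𝒜 _ M _ _ s = Po⊨NBA≤Po⊗⊨ M 𝒜 s , Po⊗⊨≤Po⊨NBA M 𝒜 s
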